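{- Let $\Gamma$ be a distance-regular graph with classical parameters $(D,b,\alpha,\beta)$ such that $b\in\{1,2,\dots,100\}$ and $D\geq 14$. Then: (i) if $b$ is not a perfect square, then $\alpha\leq b$; (ii) if $b$ is a perfect square, then $\alpha\leq b$ or $\alpha=b+\sqrt{b}$.
   Context: All graphs are finite, undirected and simple. A connected graph $\Gamma$ of diameter $D$ is distance-regular if for each $0\le i\le D$ there are integers $b_i,c_i$ such that for any two vertices $x,y$ at distance $i$, exactly $c_i$ neighbours of $y$ are at distance $i-1$ from $x$ and exactly $b_i$ neighbours of $y$ are at distance $i+1$ from $x$. Write $\left[\begin{smallmatrix} i\\ 1\end{smallmatrix}\right]_b=1+b+\dots+b^{i-1}$. A distance-regular graph of diameter $D$ has classical parameters $(D,b,\alpha,\beta)$ if for all $0\le i\le D$: $c_i=\left[\begin{smallmatrix} i\\ 1\end{smallmatrix}\right]_b\bigl(1+\alpha\left[\begin{smallmatrix} i-1\\ 1\end{smallmatrix}\right]_b\bigr)$ and $b_i=\bigl(\left[\begin{smallmatrix} D\\ 1\end{smallmatrix}\right]_b-\left[\begin{smallmatrix} i\\ 1\end{smallmatrix}\right]_b\bigr)\bigl(\beta-\alpha\left[\begin{smallmatrix} i\\ 1\end{smallmatrix}\right]_b\bigr)$. -}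

module Defs where

open import Data.Nat using (ℕ; zero; suc; _<_; _≤_; _∸_; _^_)
import Data.Nat as ℕ
open import Data.Integer using (+_)
open import Data.Rational using (ℚ; _/_) renaming (_+_ to _+ℚ_; _*_ to _*ℚ_; _-_ to _-ℚ_)
open import Data.Fin using (Fin)
open import Data.Bool using (Bool; true; false)
open import Data.Product using (Σ; _×_; ∃; ∃-syntax)
open import Relation.Binary.PropositionalEquality using (_≡_)
open import Relation.Nullary using (¬_)
open import Function.Definitions using (Injective)

record Graph (n : ℕ) : Set where
  field
    adj    : Fin n → Fin n → Bool
    sym    : ∀ x y → adj x y ≡ adj y x
    irrefl : ∀ x → adj x x ≡ false

module _ {n : ℕ} (G : Graph n) where
  open Graph G

  Edge : Fin n → Fin n → Set
  Edge x y = adj x y ≡ true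

  data Walk : Fin n → Fin n → ℕ → Set where
    nil  : ∀ {x} → Walk x x 0
    cons : ∀ {x y z k} → Edge x y → Walk y z k → Walk x z (suc k)

  Dist : Fin n → Fin n → ℕ → Set
  Dist x y d = Walk x y d × (∀ k → k < d → ¬ Walk x y k)

  Connected : Set
  Connected = ∀ x y → ∃[ d ] Dist x y d

  HasDiameter : ℕ → Set
  HasDiameter D = Connected
                × (∀ x y d → Dist x y d → d ≤ D)
                × (∃[ x ] ∃[ y ] Dist x y D)

HasExactly : {n : ℕ} → (Fin n → Set) → ℕ → Set
HasExactly {n} P c =
  Σ (Fin c → Fin n) λ f →
    Injective _≡_ _≡_ f × (∀ k → P (f k)) × (∀ z → P z → ∃[ k ] f k ≡ z)

IsDistanceRegular : {n : ℕ} → Graph n → ℕ → (ℕ → ℕ) → (ℕ → ℕ) → Set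
IsDistanceRegular {n} G D b c =
  HasDiameter G D
  × (∀ i → 1 ≤ i → i ≤ D → ∀ x y → Dist G x y i →
       HasExactly (λ z → Edge G y z × Dist G x z (i ∸ 1)) (c i))
  × (∀ i → i ≤ D → ∀ x y → Dist G x y i →
       HasExactly (λ z → Edge G y z × Dist G x z (suc i)) (b i))

ℕ→ℚ : ℕ → ℚ
ℕ→ℚ m = + m / 1

qbr : ℕ → ℕ → ℚ
qbr i b = ℕ→ℚ (go i)
  where
    go : ℕ → ℕ
    go zero    = 0
    go (suc j) = go j ℕ.+ b ^ j

ClassicalParameters : ℕ → ℕ → ℚ → ℚ → (ℕ → ℕ) → (ℕ → ℕ) → Set
ClassicalParameters D b α β bs cs =
  ∀ i → i ≤ D →
    (ℕ→ℚ (cs i) ≡ qbr i b *ℚ (ℕ→ℚ 1 +ℚ α *ℚ qbr (i ∸ 1) b))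
    × (ℕ→ℚ (bs i) ≡ (qbr D b -ℚ qbr i b) *ℚ (β -ℚ α *ℚ qbr i b))

IsPerfectSquare : ℕ → Set
IsPerfectSquare b = ∃[ s ] s ℕ.* s ≡ b

{-# OPTIONS --safe #-}
module Submission where

-- Put c₂ = (1 + b)(1 + α) and a = c₂ − (1 + b) = (1 + b)α; then c_k = [k] + a·[k choose 2]
-- (Gaussian coefficients to base b), so b and a determine all c_k.  If x and y are at distance
-- i + j, counting the edges z–w with z at distance i from x and w at distance i + 1, both on
-- geodesics from x to y, shows inductively that the number of geodesic vertices at distance i
-- from x is c_{i+1}⋯c_{i+j} / (c_1⋯c_j), which is therefore an integer.  For i = j = 2 this forces
-- c₂ to divide b²(1+b)²(1+b²)(1+b+b²), which leaves finitely many c₂ for each b; the conditions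
-- for i = j = 3,…,7 (hence D ≥ 14) are evaluated on each divisor exceeding (1+b)², and the only
-- ones passing are (1+b)(1+b+√b).

open import Defs
open import Data.Nat
open import Data.Nat.Properties hiding (suc-injective)
import Data.Nat as ℕ
open import Data.Nat.Divisibility
open import Data.Nat.DivMod using (m/n*n≡m; m*n/n≡m)
open import Data.Nat.GCD using (gcd; gcd[m,n]∣m; gcd[m,n]∣n; gcd[m,n]≢0)
open import Data.Nat.Coprimality using (coprime-/gcd; coprime-divisor)
open import Data.Nat.Tactic.RingSolver using (solve-∀)
open import Data.Integer using (+_)
import Data.Integer as ℤ
import Data.Integer.Properties as ℤ
open import Data.Rational using (ℚ; Positive; toℚᵘ)
  renaming (_≤_ to _≤ℚ_; _<_ to _<ℚ_; _+_ to _+ℚ_; _*_ to _*ℚ_)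
import Data.Rational.Properties as ℚ
open import Data.Rational.Solver using (module +-*-Solver)
open import Data.Rational.Unnormalised using (ℚᵘ; mkℚᵘ; *≡*)
  renaming (_≃_ to _≃ᵘ_; _+_ to _+ᵘ_; _*_ to _*ᵘ_)
import Data.Rational.Unnormalised as ℚᵘ
import Data.Rational.Unnormalised.Properties as ℚᵘ
open import Algebra.Properties.Group ℚ.+-0-group using (∙-cancelˡ)
open import Data.Fin using (Fin; zero; suc; combine; remQuot)
open import Data.Fin.Properties using (suc-injective; combine-injective; combine-remQuot; injective⇒≤)
open import Data.Bool using (Bool; true; false; if_then_else_; T; not; _∧_; _∨_)
open import Data.Bool.Properties using (T-≡; T-∧)
open import Data.Bool.ListAction using (all; any)
open import Data.List using (List; []; _∷_; applyUpTo; upTo; cartesianProductWith)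
open import Data.List.Membership.Propositional using (_∈_; find)
open import Data.List.Membership.Propositional.Properties using (∈-applyUpTo⁺; ∈-cartesianProductWith⁺)
open import Data.List.Relation.Unary.Any using (here; there)
open import Data.List.Relation.Unary.Any.Properties using (any⁻)
open import Data.List.Relation.Unary.All as All using ([]; _∷_)
open import Data.List.Relation.Unary.All.Properties using (all⁺; all⁻)
open import Data.Product using (_×_; _,_; proj₁; proj₂; ∃; ∃-syntax)
open import Data.Sum using (_⊎_; inj₁; inj₂)
open import Data.Empty using (⊥-elim)
open import Function using (Equivalence; _∘_)
open import Function.Definitions using (Injective)
open import Relation.Binary.PropositionalEquality
open import Relation.Nullary using (¬_; yes; no; Dec)
open import Relation.Nullary.Decidable using (_×-dec_)
open import Relation.Unary using (Decidable)

-- Enumerated finite sets and double counting.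

HasExactly-cong : ∀ {n c} {P Q : Fin n → Set} →
  (∀ z → P z → Q z) → (∀ z → Q z → P z) → HasExactly P c → HasExactly Q c
HasExactly-cong P⇒Q Q⇒P (f , f-inj , Pf , f-onto) =
  f , f-inj , (λ k → P⇒Q _ (Pf k)) , (λ z Qz → f-onto z (Q⇒P z Qz))

count : ∀ {n} {P : Fin n → Set} → Decidable P → ∃ (HasExactly P)
count {zero} P? = 0 , (λ ()) , (λ {}) , (λ ()) , (λ ())
count {suc n} P? with count (P? ∘ suc) | P? zero
... | c , f , f-inj , Pf , f-onto | no ¬P0 =
  c , suc ∘ f , f-inj ∘ suc-injective , Pf ,
  λ { zero P0 → ⊥-elim (¬P0 P0)
    ; (suc z) Pz → let k , eq = f-onto z Pz in k , cong suc eq }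
... | c , f , f-inj , Pf , f-onto | yes P0 = suc c , g , g-inj , Pg , g-onto
  where
  g : Fin (suc c) → Fin (suc n)
  g zero    = zero
  g (suc k) = suc (f k)
  g-inj : Injective _≡_ _≡_ g
  g-inj {zero}  {zero}  _  = refl
  g-inj {suc _} {suc _} eq = cong suc (f-inj (suc-injective eq))
  Pg : ∀ k → _
  Pg zero    = P0
  Pg (suc k) = Pf k
  g-onto : ∀ z → _ → ∃[ k ] g k ≡ z
  g-onto zero    _  = zero , refl
  g-onto (suc z) Pz = let k , eq = f-onto z Pz in suc k , cong suc eq

module _ {n} {P Q : Fin n → Set} {R : Fin n → Fin n → Set} where

  -- A related pair, indexed by its left element and a position in that row, is re-indexed by its
  -- right element and a position in that column. This re-indexing is injective; the reverse
  -- inequality follows by transposing the relation.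
  double-count-≤ : ∀ {p q r s} → HasExactly P p → HasExactly Q q →
    (∀ x → P x → HasExactly (λ y → Q y × R x y) r) →
    (∀ y → Q y → HasExactly (λ x → P x × R x y) s) → p * r ≤ q * s
  double-count-≤ {p} {q} {r} {s} (f , f-inj , Pf , _) (g , g-inj , Qg , g-onto) row col =
    injective⇒≤ {f = φ} φ-inj
    where
    right : (k : Fin p) (l : Fin r) → Fin n
    right k l = proj₁ (row (f k) (Pf k)) l

    right-sat : ∀ k l → Q (right k l) × R (f k) (right k l)
    right-sat k = proj₁ (proj₂ (proj₂ (row (f k) (Pf k))))

    left : (k : Fin q) (l : Fin s) → Fin n
    left k l = proj₁ (col (g k) (Qg k)) l

    code : ∀ k l → ∃[ k′ ] g k′ ≡ right k l × ∃[ l′ ] left k′ l′ ≡ f k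
    code k l with right-sat k l
    ... | Qy , Rxy with g-onto _ Qy
    ... | k′ , eq = k′ , eq , proj₂ (proj₂ (proj₂ (col (g k′) (Qg k′)))) (f k)
                               (Pf k , subst (R (f k)) (sym eq) Rxy)

    encode : ∀ k l → Fin q × Fin s
    encode k l = let k′ , _ , l′ , _ = code k l in k′ , l′

    encode-inj : ∀ k₁ l₁ k₂ l₂ → encode k₁ l₁ ≡ encode k₂ l₂ → k₁ ≡ k₂ × l₁ ≡ l₂
    encode-inj k₁ l₁ k₂ l₂ eq = k₁≡k₂ , l₁≡l₂ k₁≡k₂
      where
      c₁ = code k₁ l₁
      c₂ = code k₂ l₂
      x≡ : f k₁ ≡ f k₂
      x≡ = trans (sym (proj₂ (proj₂ (proj₂ c₁))))
             (trans (cong (λ (k , l) → left k l) eq) (proj₂ (proj₂ (proj₂ c₂))))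
      y≡ : right k₁ l₁ ≡ right k₂ l₂
      y≡ = trans (sym (proj₁ (proj₂ c₁))) (trans (cong (g ∘ proj₁) eq) (proj₁ (proj₂ c₂)))
      k₁≡k₂ : k₁ ≡ k₂
      k₁≡k₂ = f-inj x≡
      -- Each row has its own enumeration, so positions can be compared only after the rows are
      -- identified.
      l₁≡l₂ : k₁ ≡ k₂ → l₁ ≡ l₂
      l₁≡l₂ refl = proj₁ (proj₂ (row (f k₁) (Pf k₁))) y≡

    φ : Fin (p * r) → Fin (q * s)
    φ i = let k , l = remQuot {p} r i ; k′ , l′ = encode k l in combine k′ l′

    φ-inj : Injective _≡_ _≡_ φ
    φ-inj {i} {j} eq =
      let k₁ , l₁ = remQuot {p} r i
          k₂ , l₂ = remQuot {p} r j
          eqk , eql = combine-injective _ _ _ _ eq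
          k≡ , l≡ = encode-inj k₁ l₁ k₂ l₂ (cong₂ _,_ eqk eql)
      in trans (sym (combine-remQuot {p} r i)) (trans (cong₂ combine k≡ l≡) (combine-remQuot {p} r j))

double-count : ∀ {n p q r s} {P Q : Fin n → Set} {R : Fin n → Fin n → Set} →
  HasExactly P p → HasExactly Q q →
  (∀ x → P x → HasExactly (λ y → Q y × R x y) r) →
  (∀ y → Q y → HasExactly (λ x → P x × R x y) s) → p * r ≡ q * s
double-count {R = R} #P #Q row col = ≤-antisym
  (double-count-≤ {R = R} #P #Q row col)
  (double-count-≤ {R = λ y x → R x y} #Q #P col row)

-- Products of consecutive intersection numbers.

rising : (ℕ → ℕ) → ℕ → ℕ → ℕ
rising c i zero    = 1
rising c i (suc j) = c (suc i) * rising c (suc i) j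

-- The recursion peels off the first factor. In `#Between` the numerator loses its first factor
-- while the denominator loses its last, so both forms occur.
rising-snoc : ∀ c i j → rising c i (suc j) ≡ rising c i j * c (suc (i + j))
rising-snoc c i zero rewrite +-identityʳ i = *-comm (c (suc i)) 1
rising-snoc c i (suc j) rewrite +-suc i j = begin
  c (suc i) * rising c (suc i) (suc j)                        ≡⟨ cong (c (suc i) *_) (rising-snoc c (suc i) j) ⟩
  c (suc i) * (rising c (suc i) j * c (suc (suc (i + j))))    ≡⟨ *-assoc (c (suc i)) _ _ ⟨
  c (suc i) * rising c (suc i) j * c (suc (suc (i + j)))      ∎
  where open ≡-Reasoning

rising-cong : ∀ {c c′} i j → (∀ k → k < i + j → c (suc k) ≡ c′ (suc k)) → rising c i j ≡ rising c′ i j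
rising-cong i zero    eq = refl
rising-cong i (suc j) eq rewrite +-suc i j = cong₂ _*_ (eq i (m≤m+n (suc i) j)) (rising-cong (suc i) j eq)

-- Distances and the number of geodesic vertices at a given level.

module _ {n} (G : Graph n) where
  open Graph G using (adj) renaming (sym to adj-sym)

  Edge-sym : ∀ {x y} → Edge G x y → Edge G y x
  Edge-sym {x} {y} = trans (adj-sym y x)

  infixr 5 _⋯_
  _⋯_ : ∀ {x y z k l} → Walk G x y k → Walk G y z l → Walk G x z (k + l)
  nil      ⋯ v = v
  cons e w ⋯ v = cons e (w ⋯ v)

  Walk-sym : ∀ {x y k} → Walk G x y k → Walk G y x k
  Walk-sym nil = nil
  Walk-sym {k = suc k} (cons e w) =
    subst (Walk G _ _) (+-comm k 1) (Walk-sym w ⋯ cons (Edge-sym e) nil)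

  Dist-sym : ∀ {x y d} → Dist G x y d → Dist G y x d
  Dist-sym (w , min) = Walk-sym w , λ k k<d v → min k k<d (Walk-sym v)

  Dist-≤ : ∀ {x y d k} → Dist G x y d → Walk G x y k → d ≤ k
  Dist-≤ {d = d} {k} (_ , min) v = ≮⇒≥ (λ k<d → min k k<d v)

  Dist-unique : ∀ {x y d e} → Dist G x y d → Dist G x y e → d ≡ e
  Dist-unique p q = ≤-antisym (Dist-≤ p (proj₁ q)) (Dist-≤ q (proj₁ p))

  -- An initial segment of a geodesic is a geodesic: a shortcut to `y` would also shorten the walk
  -- to `z`.
  Dist-split : ∀ {x y z i j} → Dist G x z (i + j) → Walk G x y i → Walk G y z j → Dist G x y i
  Dist-split {i = i} {j} d w v =
    w , λ k k<i u → <⇒≱ k<i (+-cancelʳ-≤ j i k (Dist-≤ d (u ⋯ v)))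

  Dist-splitʳ : ∀ {x y z i j} → Dist G x z (i + j) → Walk G x y i → Walk G y z j → Dist G y z j
  Dist-splitʳ {i = i} {j} d w v =
    v , λ k k<j u → <⇒≱ k<j (+-cancelˡ-≤ i j k (Dist-≤ d (w ⋯ u)))

  Dist? : Connected G → ∀ x y d → Dec (Dist G x y d)
  Dist? conn x y d with conn x y
  ... | e , D with e ≟ d
  ...   | yes refl = yes D
  ...   | no  e≢d  = no (λ D′ → e≢d (Dist-unique D D′))

  -- Obtained by walking along a geodesic towards `y`. Applied to a diametral pair, it provides a
  -- pair at every distance up to the diameter.
  shorter-distance : ∀ {x y d e} → e ≤ d → Dist G x y d → ∃[ z ] Dist G z y e
  shorter-distance {d = d} {e} e≤d D = go _ (subst (Dist G _ _) (sym (m∸n+n≡m e≤d)) D)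
    where
    go : ∀ {x y} k → Dist G x y (k + e) → ∃[ z ] Dist G z y e
    go zero D = _ , D
    go (suc k) D@(cons ed w , _) = go k (Dist-splitʳ {i = 1} D (cons ed nil) w)

  Between : (x y : Fin n) (i j : ℕ) → Fin n → Set
  Between x y i j z = Dist G x z i × Dist G z y j

  module _ {D : ℕ} {bs cs : ℕ → ℕ} (reg : IsDistanceRegular G D bs cs) where

    private
      conn = proj₁ (proj₁ reg)
      c-reg = proj₁ (proj₂ reg)

    -- Edges between consecutive levels are counted from both ends. A neighbour of `z` closer to `y`
    -- automatically lies at the next level from `x`, by `Dist-split`, so regularity based at `y`
    -- gives the upward degree; regularity based at `x` gives the downward one.
    Between-step : ∀ {x y i j N M} → suc (i + j) ≤ D → Dist G x y (suc (i + j)) →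
      HasExactly (Between x y i (suc j)) N → HasExactly (Between x y (suc i) j) M →
      N * cs (suc j) ≡ M * cs (suc i)
    Between-step {x} {y} {i} {j} ≤D dxy #N #M =
      double-count {R = λ z w → Edge G z w} #N #M closer farther
      where
      dxy′ : Dist G x y (i + suc j)
      dxy′ = subst (Dist G x y) (sym (+-suc i j)) dxy

      closer : ∀ z → Between x y i (suc j) z →
        HasExactly (λ w → Between x y (suc i) j w × Edge G z w) (cs (suc j))
      closer z (xz , zy) = HasExactly-cong
        (λ w (zw , yw) →
           let wxw = subst (Walk G x w) (+-comm i 1) (proj₁ xz ⋯ cons zw nil)
               wwy = Walk-sym (proj₁ yw)
           in (Dist-split {i = suc i} {j} dxy wxw wwy , Dist-sym yw) , zw)
        (λ w ((_ , wy) , zw) → zw , Dist-sym wy)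
        (c-reg (suc j) (s≤s z≤n) (≤-trans (s≤s (m≤n+m j i)) ≤D) y z (Dist-sym zy))

      farther : ∀ w → Between x y (suc i) j w →
        HasExactly (λ z → Between x y i (suc j) z × Edge G z w) (cs (suc i))
      farther w (xw , wy) = HasExactly-cong
        (λ z (wz , xz) →
           (xz , Dist-splitʳ {i = i} {suc j} dxy′ (proj₁ xz) (cons (Edge-sym wz) (proj₁ wy))) ,
           Edge-sym wz)
        (λ z ((xz , _) , zw) → Edge-sym zw , xz)
        (c-reg (suc i) (s≤s z≤n) (≤-trans (s≤s (m≤m+n i j)) ≤D) x w xw)

    -- Induction on `j` moves the level towards `y`, ending at the level that consists of `y` alone.
    #Between : ∀ {x y} i j → i + j ≤ D → Dist G x y (i + j) →
      ∃[ N ] HasExactly (Between x y i j) N × N * rising cs 0 j ≡ rising cs i j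
    #Between {x} {y} i zero ≤D dxy =
      1 , ((λ _ → y) , (λ { {zero} {zero} _ → refl }) , (λ _ → dxy′ , nil , λ _ ()) ,
           λ { z (_ , nil , _) → zero , refl }) , refl
      where
      dxy′ = subst (Dist G x y) (+-identityʳ i) dxy
    #Between {x} {y} i (suc j) ≤D dxy =
      N , #N , (begin
        N * rising cs 0 (suc j)                ≡⟨ cong (N *_) (rising-snoc cs 0 j) ⟩
        N * (rising cs 0 j * cs (suc j))       ≡⟨ cong (N *_) (*-comm (rising cs 0 j) _) ⟩
        N * (cs (suc j) * rising cs 0 j)       ≡⟨ *-assoc N _ _ ⟨
        N * cs (suc j) * rising cs 0 j         ≡⟨ cong (_* rising cs 0 j) (Between-step ≤D′ dxy′ #N #M) ⟩
        M * cs (suc i) * rising cs 0 j         ≡⟨ cong (_* rising cs 0 j) (*-comm M _) ⟩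
        cs (suc i) * M * rising cs 0 j         ≡⟨ *-assoc (cs (suc i)) _ _ ⟩
        cs (suc i) * (M * rising cs 0 j)       ≡⟨ cong (cs (suc i) *_) eq ⟩
        cs (suc i) * rising cs (suc i) j       ∎)
      where
      open ≡-Reasoning
      ≤D′ : suc (i + j) ≤ D
      ≤D′ = subst (_≤ D) (+-suc i j) ≤D
      dxy′ : Dist G x y (suc (i + j))
      dxy′ = subst (Dist G x y) (+-suc i j) dxy
      rec = #Between (suc i) j ≤D′ dxy′
      M = proj₁ rec
      #M = proj₁ (proj₂ rec)
      eq = proj₂ (proj₂ rec)
      -- Regularity does not directly enumerate this level, so its size comes from a search over all
      -- vertices; connectedness makes membership decidable.
      cnt = count (λ z → Dist? conn x z i ×-dec Dist? conn z y (suc j))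
      N = proj₁ cnt
      #N = proj₂ cnt

    rising-divisible : ∀ i j → i + j ≤ D → rising cs 0 j ∣ rising cs i j
    rising-divisible i j ≤D =
      let _ , _ , dxy = proj₂ (proj₂ (proj₁ reg))
          N , _ , eq = #Between i j ≤D (proj₂ (shorter-distance ≤D dxy))
      in divides N (sym eq)

-- Gaussian coefficients and the divisibility condition on c₂.

bracket : ℕ → ℕ → ℕ
bracket b zero    = 0
bracket b (suc k) = bracket b k + b ^ k

-- The Gaussian coefficient [k choose 2] to base `b`, computed by the q-Pascal rule so that no
-- division occurs.
gauss₂ : ℕ → ℕ → ℕ
gauss₂ b zero    = 0
gauss₂ b (suc k) = bracket b k + b * b * gauss₂ b k

bracket-suc : ∀ b k → bracket b (suc k) ≡ 1 + b * bracket b k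
bracket-suc b zero    = cong suc (sym (*-zeroʳ b))
bracket-suc b (suc k) = begin
  bracket b (suc k) + b * b ^ k          ≡⟨ cong (_+ b * b ^ k) (bracket-suc b k) ⟩
  1 + b * bracket b k + b * b ^ k        ≡⟨ cong suc (*-distribˡ-+ b (bracket b k) (b ^ k)) ⟨
  1 + b * bracket b (suc k)              ∎
  where open ≡-Reasoning

-- The quotient formula for [k + 1 choose 2] with its denominator cleared. It turns the term
-- α[k + 1][k] of c_{k+1} into `a` times a Gaussian coefficient.
gauss₂-bracket : ∀ b k → suc b * gauss₂ b (suc k) ≡ bracket b (suc k) * bracket b k
gauss₂-bracket b zero    = lemma b
  where
  lemma : ∀ b → (1 + b) * (0 + b * b * 0) ≡ 1 * 0
  lemma = solve-∀
gauss₂-bracket b (suc k) = begin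
  suc b * (B′ + b * b * gauss₂ b (suc k))          ≡⟨ lemma₁ b B′ (gauss₂ b (suc k)) ⟩
  suc b * B′ + b * b * (suc b * gauss₂ b (suc k))  ≡⟨ cong (λ z → suc b * B′ + b * b * z) (gauss₂-bracket b k) ⟩
  suc b * B′ + b * b * (B′ * B)                  ≡⟨ lemma₂ b B B′ ⟩
  (1 + b * (1 + b * B)) * B′                     ≡⟨ cong (λ z → (1 + b * z) * B′) (bracket-suc b k) ⟨
  (1 + b * B′) * B′                              ≡⟨ cong (_* B′) (bracket-suc b (suc k)) ⟨
  bracket b (suc (suc k)) * B′                   ∎
  where
  open ≡-Reasoning
  B = bracket b k
  B′ = bracket b (suc k)
  lemma₁ : ∀ b x y → (1 + b) * (x + b * b * y) ≡ (1 + b) * x + b * b * ((1 + b) * y)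
  lemma₁ = solve-∀
  lemma₂ : ∀ b x y → (1 + b) * y + b * b * (y * x) ≡ (1 + b * (1 + b * x)) * y
  lemma₂ = solve-∀

intersection : ℕ → ℕ → ℕ → ℕ
intersection b a k = bracket b k + a * gauss₂ b k

-- Bracketed as a product of two products, so that `∣*⇒factors` splits a divisor into four parts.
c₂-modulus : ℕ → ℕ
c₂-modulus b = b * b * (suc b * suc b) * ((1 + b * b) * (1 + b + b * b))

-- Modulo c₂ one has a ≡ −(1 + b), hence c₃ ≡ −b(1 + b + b²) and c₄ ≡ −b(1 + b)²(1 + b²).  The
-- multiple excess of c₂ is added to c₃c₄ so that no subtraction occurs.
c₂∣c₂-modulus : ∀ b a → rising (intersection b a) 0 2 ∣ rising (intersection b a) 2 2 →
  suc b + a ∣ c₂-modulus b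
c₂∣c₂-modulus b a d = ∣m+n∣m⇒∣n
  (subst₂ _∣_ (c₂ b a) (identity b a) (∣m∣n⇒∣m+n d (subst (_∣ excess) (sym (c₂ b a)) (m∣m*n _))))
  (m∣m*n _)
  where
  excess = (1 + b + a) * ((1 + b + b * b) * (1 + b * b) * (b * ((1 + b) * (1 + b)) + b * (1 + b + b * b)))
  c₂ : ∀ b a → (0 + 1 + a * (0 + b * b * 0)) * ((0 + 1 + b * 1 + a * (0 + 1 + b * b * (0 + b * b * 0))) * 1) ≡ 1 + b + a
  c₂ = solve-∀
  identity : ∀ b a →
    (0 + 1 + b * 1 + b * (b * 1) + a * (0 + 1 + b * 1 + b * b * (0 + 1 + b * b * (0 + b * b * 0)))) *
    ((0 + 1 + b * 1 + b * (b * 1) + b * (b * (b * 1)) +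
      a * (0 + 1 + b * 1 + b * (b * 1) + b * b * (0 + 1 + b * 1 + b * b * (0 + 1 + b * b * (0 + b * b * 0))))) * 1)
    + (1 + b + a) * ((1 + b + b * b) * (1 + b * b) * (b * ((1 + b) * (1 + b)) + b * (1 + b + b * b)))
    ≡ (1 + b + a) * ((1 + b + b * b) * (1 + b * b) * ((1 + b + a) * (1 + b + b * b)))
      + b * b * ((1 + b) * (1 + b)) * ((1 + b * b) * (1 + b + b * b))
  identity = solve-∀

-- Enumeration of divisors.

-- Take `d` to be g = gcd(t, m). Then t/g is coprime to m/g and divides (m/g)n, hence divides `n`.
∣*⇒factors : ∀ {t} m n .{{_ : NonZero t}} → t ∣ m * n → ∃[ d ] ∃[ e ] d ∣ m × e ∣ n × t ≡ d * e
∣*⇒factors {t} m n t∣mn =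
  g , t / g , gcd[m,n]∣n t m ,
  coprime-divisor (coprime-/gcd t m) (*-cancelʳ-∣ g (subst₂ _∣_ (sym (m/n*n≡m (gcd[m,n]∣m t m))) regroup t∣mn)) ,
  trans (sym (m/n*n≡m (gcd[m,n]∣m t m))) (*-comm (t / g) g)
  where
  g = gcd t m
  instance
    g≢0 : NonZero g
    g≢0 = ≢-nonZero (gcd[m,n]≢0 t m (inj₁ (≢-nonZero⁻¹ t)))
  regroup : m * n ≡ m / g * n * g
  regroup = begin
    m * n             ≡⟨ cong (_* n) (m/n*n≡m (gcd[m,n]∣n t m)) ⟨
    m / g * g * n     ≡⟨ *-assoc (m / g) g n ⟩
    m / g * (g * n)   ≡⟨ cong (m / g *_) (*-comm g n) ⟩
    m / g * (n * g)   ≡⟨ *-assoc (m / g) n g ⟨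
    m / g * n * g     ∎
    where open ≡-Reasoning

divides? : ℕ → ℕ → Bool
divides? zero    n = n ≡ᵇ 0
divides? (suc d) n = n % suc d ≡ᵇ 0

divides?-complete : ∀ {d n} → d ∣ n → T (divides? d n)
divides?-complete {zero}  0∣n = ≡⇒≡ᵇ _ _ (0∣⇒≡0 0∣n)
divides?-complete {suc d} d∣n = ≡⇒≡ᵇ _ _ (n∣m⇒m%n≡0 _ _ d∣n)

-- Trial division by d ≤ r only, recording d together with its codivisor.
divisorPairs : ℕ → ℕ → List ℕ
divisorPairs m zero    = []
divisorPairs m (suc r) =
  if divides? (suc r) m then suc r ∷ m / suc r ∷ divisorPairs m r else divisorPairs m r

∈-divisorPairs : ∀ {m k l} r → m ≡ k * l → 1 ≤ k → k ≤ r → k ∈ divisorPairs m r × l ∈ divisorPairs m r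
∈-divisorPairs {m} {k} {l} zero eq 1≤k k≤0 = ⊥-elim (<⇒≱ 1≤k k≤0)
∈-divisorPairs {m} {k} {l} (suc r) eq 1≤k k≤r with divides? (suc r) m in div | k ≟ suc r
... | true  | yes refl = here refl , there (here (sym l≡))
  where
  l≡ : m / suc r ≡ l
  l≡ = trans (cong (_/ suc r) (trans eq (*-comm (suc r) l))) (m*n/n≡m l (suc r))
... | true  | no  k≢ =
  let p , q = ∈-divisorPairs r eq 1≤k (≤-pred (≤∧≢⇒< k≤r k≢)) in there (there p) , there (there q)
... | false | no  k≢ = ∈-divisorPairs r eq 1≤k (≤-pred (≤∧≢⇒< k≤r k≢))
... | false | yes refl = ⊥-elim (subst T div (divides?-complete {suc r} {m} (divides l (trans eq (*-comm (suc r) l)))))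

-- A divisor and its codivisor cannot both exceed `r`, as their product is at most `r * r`.
-- Whichever is small is found by trial division, and the other is recorded with it.
∣⇒∈-divisorPairs : ∀ {m d} r → 1 ≤ m → m ≤ r * r → d ∣ m → d ∈ divisorPairs m r
∣⇒∈-divisorPairs {m} {d} r 1≤m m≤r² (divides e eq) with d ≤? r | e ≤? r
... | yes d≤r | _ = proj₁ (∈-divisorPairs {l = e} r (trans eq (*-comm e d)) 1≤d d≤r)
  where
  1≤d : 1 ≤ d
  1≤d = n≢0⇒n>0 (λ { refl → <⇒≢ 1≤m (sym (trans eq (*-zeroʳ e))) })
... | no  _   | yes e≤r = proj₂ (∈-divisorPairs {k = e} r eq 1≤e e≤r)
  where
  1≤e : 1 ≤ e
  1≤e = n≢0⇒n>0 (λ { refl → <⇒≢ 1≤m (sym eq) })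
... | no  d≰r | no  e≰r = ⊥-elim (<⇒≱ (*-mono-< (≰⇒> e≰r) (≰⇒> d≰r)) (≤-trans (≤-reflexive (sym eq)) m≤r²))

-- Each of the four factors of `c₂-modulus b` is at most (1 + b)², so trial division up to `suc b`
-- finds all of its divisors.
candidates : ℕ → List ℕ
candidates b = cartesianProductWith _*_
  (cartesianProductWith _*_ (divisorPairs (b * b) (suc b)) (divisorPairs (suc b * suc b) (suc b)))
  (cartesianProductWith _*_ (divisorPairs (1 + b * b) (suc b)) (divisorPairs (1 + b + b * b) (suc b)))

∣c₂-modulus⇒∈candidates : ∀ {b t} .{{_ : NonZero t}} → 1 ≤ b → t ∣ c₂-modulus b → t ∈ candidates b
∣c₂-modulus⇒∈candidates {b} {t} 1≤b t∣ with ∣*⇒factors (b * b * (suc b * suc b)) _ t∣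
... | d , e , d∣ , e∣ , refl
  with ∣*⇒factors {d} (b * b) (suc b * suc b) {{m*n≢0⇒m≢0 d}} d∣
     | ∣*⇒factors {e} (1 + b * b) (1 + b + b * b) {{m*n≢0⇒n≢0 d}} e∣
... | d₁ , d₂ , d₁∣ , d₂∣ , refl | e₁ , e₂ , e₁∣ , e₂∣ , refl =
  ∈-cartesianProductWith⁺ _*_
    (∈-cartesianProductWith⁺ _*_
      (∣⇒∈-divisorPairs (suc b) (*-mono-≤ 1≤b 1≤b) (*-mono-≤ (n≤1+n b) (n≤1+n b)) d₁∣)
      (∣⇒∈-divisorPairs (suc b) (s≤s z≤n) ≤-refl d₂∣))
    (∈-cartesianProductWith⁺ _*_
      (∣⇒∈-divisorPairs (suc b) (s≤s z≤n) (≤-trans (s≤s (m≤n+m (b * b) b)) bound) e₁∣)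
      (∣⇒∈-divisorPairs (suc b) (s≤s z≤n) bound e₂∣))
  where
  bound : 1 + b + b * b ≤ suc b * suc b
  bound = s≤s (+-monoʳ-≤ b (*-monoʳ-≤ b (n≤1+n b)))

-- The finite check.

divisible? : (ℕ → ℕ) → ℕ → Bool
divisible? c m = divides? (rising c 0 m) (rising c m m)

-- c₂ = (1 + b)(1 + b + √b) is attained by the half dual polar graphs.
halfDualPolar? : ℕ → ℕ → ℕ → Bool
halfDualPolar? b t s = (s * s ≡ᵇ b) ∧ (t ≡ᵇ suc b * (suc b + s))

-- With t = c₂, the first disjunct says α ≤ b.
test : ℕ → ℕ → Bool
test b t =
  (t ≤ᵇ suc b * suc b)
  ∨ not (all (divisible? (intersection b (t ∸ suc b))) (3 ∷ 4 ∷ 5 ∷ 6 ∷ 7 ∷ []))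
  ∨ any (halfDualPolar? b t) (upTo 11)

testAll : ℕ → Bool
testAll b = all (test b) (candidates b)

abstract
  -- Verified by evaluation for b = 1,...,100. The proof is sealed, so later arguments use only the
  -- equation.
  testAll-true : all testAll (applyUpTo suc 100) ≡ true
  testAll-true = refl

all⇒∈ : ∀ {A : Set} (p : A → Bool) {xs x} → all p xs ≡ true → x ∈ xs → T (p x)
all⇒∈ p eq = All.lookup (all⁺ p _ (Equivalence.from T-≡ eq))

discharge : ∀ {x y} → T (not x ∨ y) → T x → T y
discharge {true} p _ = p

-- The Boolean shape of `test` with its constituents as variables, so that the case analysis
-- involves none of the large products.
test-elim : ∀ x (p q : ℕ → Bool) xs → T (x ∨ not (all p (3 ∷ 4 ∷ 5 ∷ 6 ∷ 7 ∷ [])) ∨ any q xs) →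
  ¬ T x → (∀ m → m ≤ 7 → T (p m)) → ∃[ s ] T (q s)
test-elim true  p q xs _ ¬x _ = ⊥-elim (¬x _)
test-elim false p q xs h _  P =
  let s , _ , ok = find (any⁻ q xs (discharge {all p (3 ∷ 4 ∷ 5 ∷ 6 ∷ 7 ∷ [])} h (all⁻ p
                     (P 3 (m≤m+n 3 4) ∷ P 4 (m≤m+n 4 3) ∷ P 5 (m≤m+n 5 2) ∷ P 6 (m≤m+n 6 1) ∷ P 7 ≤-refl ∷ []))))
  in s , ok

test-sound : ∀ b t → T (test b t) → suc b * suc b < t →
  (∀ m → m ≤ 7 → rising (intersection b (t ∸ suc b)) 0 m ∣ rising (intersection b (t ∸ suc b)) m m) →
  ∃[ s ] s * s ≡ b × t ≡ suc b * (suc b + s)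
test-sound b t passed t> div =
  -- `upTo 11` lists 0,...,10, which includes the root of every square up to 100.
  let s , ok = test-elim (t ≤ᵇ suc b * suc b)
                 (divisible? (intersection b (t ∸ suc b))) (halfDualPolar? b t) (upTo 11) passed
                 (λ t≤ → <⇒≱ t> (≤ᵇ⇒≤ _ _ t≤)) passes
      s² , t≡ = Equivalence.to (T-∧ {s * s ≡ᵇ b}) ok
  in s , ≡ᵇ⇒≡ _ _ s² , ≡ᵇ⇒≡ _ _ t≡
  where
  passes : ∀ m → m ≤ 7 → T (divisible? (intersection b (t ∸ suc b)) m)
  passes m m≤7 = divides?-complete (div m m≤7)

large-c₂ : ∀ {b a} → 1 ≤ b → b ≤ 100 → suc b * suc b < suc b + a →
  (∀ m → m ≤ 7 → rising (intersection b a) 0 m ∣ rising (intersection b a) m m) →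
  ∃[ s ] s * s ≡ b × suc b + a ≡ suc b * (suc b + s)
-- Matching on `1≤b` exposes `b` as a successor, so `b≤` also bounds its position in
-- `applyUpTo suc 100`.
large-c₂ {b} {a} 1≤b@(s≤s _) b≤ c₂> div =
  test-sound b (suc b + a)
    (all⇒∈ (test b) {candidates b} {suc b + a}
      (Equivalence.to T-≡ (all⇒∈ testAll {applyUpTo suc 100} {b} testAll-true (∈-applyUpTo⁺ suc b≤)))
      (∣c₂-modulus⇒∈candidates 1≤b (c₂∣c₂-modulus b a (div 2 (m≤m+n 2 5)))))
    c₂>
    (subst (λ x → ∀ m → m ≤ 7 → rising (intersection b x) 0 m ∣ rising (intersection b x) m m)
      (sym (m+n∸m≡n (suc b) a)) div)

-- Natural numbers inside the rationals.

-- The recursion inside qbr is local to its definition and cannot be named, but it unfolds at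
-- each numeral.
qbr≡bracket : ∀ b {i} → i ≤ 14 → qbr i b ≡ ℕ→ℚ (bracket b i)
qbr≡bracket b {0} _ = refl
qbr≡bracket b {1} _ = refl
qbr≡bracket b {2} _ = refl
qbr≡bracket b {3} _ = refl
qbr≡bracket b {4} _ = refl
qbr≡bracket b {5} _ = refl
qbr≡bracket b {6} _ = refl
qbr≡bracket b {7} _ = refl
qbr≡bracket b {8} _ = refl
qbr≡bracket b {9} _ = refl
qbr≡bracket b {10} _ = refl
qbr≡bracket b {11} _ = refl
qbr≡bracket b {12} _ = refl
qbr≡bracket b {13} _ = refl
qbr≡bracket b {14} _ = refl
qbr≡bracket b {suc (suc (suc (suc (suc (suc (suc (suc (suc (suc (suc (suc (suc (suc (suc i))))))))))))))} i≤14 =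
  ⊥-elim (<⇒≱ (m≤m+n 15 i) i≤14)

-- Unnormalised fractions with denominator one (stored as its predecessor 0): on these the laws for
-- `ℕ→ℚ` reduce to integer arithmetic.
ℕ→ℚᵘ : ℕ → ℚᵘ
ℕ→ℚᵘ m = mkℚᵘ (+ m) 0

toℚᵘ-ℕ→ℚ : ∀ m → toℚᵘ (ℕ→ℚ m) ≃ᵘ ℕ→ℚᵘ m
toℚᵘ-ℕ→ℚ m = ℚ.toℚᵘ-fromℚᵘ (ℕ→ℚᵘ m)

ℕ→ℚ-+ : ∀ m n → ℕ→ℚ (m + n) ≡ ℕ→ℚ m +ℚ ℕ→ℚ n
ℕ→ℚ-+ m n = ℚ.toℚᵘ-injective (begin
  toℚᵘ (ℕ→ℚ (m + n))               ≈⟨ toℚᵘ-ℕ→ℚ (m + n) ⟩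
  ℕ→ℚᵘ (m + n)                     ≈⟨ *≡* (cong (ℤ._* + 1) (cong₂ ℤ._+_ (ℤ.*-identityʳ (+ m)) (ℤ.*-identityʳ (+ n)))) ⟨
  ℕ→ℚᵘ m +ᵘ ℕ→ℚᵘ n                 ≈⟨ ℚᵘ.+-cong (toℚᵘ-ℕ→ℚ m) (toℚᵘ-ℕ→ℚ n) ⟨
  toℚᵘ (ℕ→ℚ m) +ᵘ toℚᵘ (ℕ→ℚ n)     ≈⟨ ℚ.toℚᵘ-homo-+ (ℕ→ℚ m) (ℕ→ℚ n) ⟨
  toℚᵘ (ℕ→ℚ m +ℚ ℕ→ℚ n)            ∎)
  where open import Relation.Binary.Reasoning.Setoid ℚᵘ.≃-setoid

ℕ→ℚ-* : ∀ m n → ℕ→ℚ (m * n) ≡ ℕ→ℚ m *ℚ ℕ→ℚ n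
ℕ→ℚ-* m n = ℚ.toℚᵘ-injective (begin
  toℚᵘ (ℕ→ℚ (m * n))               ≈⟨ toℚᵘ-ℕ→ℚ (m * n) ⟩
  ℕ→ℚᵘ (m * n)                     ≈⟨ *≡* (cong (ℤ._* + 1) (ℤ.pos-* m n)) ⟩
  ℕ→ℚᵘ m *ᵘ ℕ→ℚᵘ n                 ≈⟨ ℚᵘ.*-cong (toℚᵘ-ℕ→ℚ m) (toℚᵘ-ℕ→ℚ n) ⟨
  toℚᵘ (ℕ→ℚ m) *ᵘ toℚᵘ (ℕ→ℚ n)     ≈⟨ ℚ.toℚᵘ-homo-* (ℕ→ℚ m) (ℕ→ℚ n) ⟨
  toℚᵘ (ℕ→ℚ m *ℚ ℕ→ℚ n)            ∎)
  where open import Relation.Binary.Reasoning.Setoid ℚᵘ.≃-setoid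

ℕ→ℚ-injective : ∀ {m n} → ℕ→ℚ m ≡ ℕ→ℚ n → m ≡ n
ℕ→ℚ-injective {m} {n} eq with ℚ.fromℚᵘ-injective {ℕ→ℚᵘ m} {ℕ→ℚᵘ n} eq
... | *≡* eq′ = ℤ.+-injective (trans (sym (ℤ.*-identityʳ (+ m))) (trans eq′ (ℤ.*-identityʳ (+ n))))

ℕ→ℚ-cancel-< : ∀ {m n} → ℕ→ℚ m <ℚ ℕ→ℚ n → m < n
ℕ→ℚ-cancel-< {m} {n} m<n
  with ℚᵘ.<-respˡ-≃ (toℚᵘ-ℕ→ℚ m) (ℚᵘ.<-respʳ-≃ (toℚᵘ-ℕ→ℚ n) (ℚ.toℚᵘ-mono-< m<n))
... | ℚᵘ.*<* lt = ℤ.drop‿+<+ (subst₂ ℤ._<_ (ℤ.*-identityʳ (+ m)) (ℤ.*-identityʳ (+ n)) lt)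

ℕ→ℚ-positive : ∀ n → Positive (ℕ→ℚ (suc n))
ℕ→ℚ-positive n = ℚ.normalize-pos (suc n) 1

ℚ-*-cancelˡ : ∀ r .{{_ : Positive r}} {p q} → r *ℚ p ≡ r *ℚ q → p ≡ q
ℚ-*-cancelˡ r eq = ℚ.≤-antisym
  (ℚ.*-cancelˡ-≤-pos r (ℚ.≤-reflexive eq)) (ℚ.*-cancelˡ-≤-pos r (ℚ.≤-reflexive (sym eq)))

-- Intersection numbers in terms of b and a.

module _ {D b : ℕ} {α β : ℚ} {bs cs : ℕ → ℕ} (cp : ClassicalParameters D b α β bs cs) (14≤D : 14 ≤ D) where

  cs-suc : ∀ {k} → k < 14 → ℕ→ℚ (cs (suc k)) ≡ ℕ→ℚ (bracket b (suc k)) *ℚ (ℕ→ℚ 1 +ℚ α *ℚ ℕ→ℚ (bracket b k))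
  cs-suc {k} k<14 = trans (proj₁ (cp (suc k) (≤-trans k<14 14≤D)))
    (cong₂ (λ x y → x *ℚ (ℕ→ℚ 1 +ℚ α *ℚ y)) (qbr≡bracket b k<14) (qbr≡bracket b (<⇒≤ k<14)))

  c₂-formula : ℕ→ℚ (cs 2) ≡ ℕ→ℚ (suc b) *ℚ (ℕ→ℚ 1 +ℚ α)
  c₂-formula = trans (cs-suc {1} (m≤m+n 2 12))
    (cong₂ (λ x y → ℕ→ℚ x *ℚ (ℕ→ℚ 1 +ℚ y)) (cong suc (*-identityʳ b)) (ℚ.*-identityʳ α))

  -- As c₂ = (1 + b)(1 + α) increases with α, the threshold α = b corresponds to c₂ = (1 + b)².
  c₂-large : ℕ→ℚ b <ℚ α → suc b * suc b < cs 2
  c₂-large b<α = ℕ→ℚ-cancel-< (subst₂ _<ℚ_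
    (sym (trans (ℕ→ℚ-* (suc b) (suc b)) (cong (ℕ→ℚ (suc b) *ℚ_) (ℕ→ℚ-+ 1 b)))) (sym c₂-formula)
    (ℚ.*-monoʳ-<-pos (ℕ→ℚ (suc b)) {{ℕ→ℚ-positive b}} (ℚ.+-monoʳ-< (ℕ→ℚ 1) b<α)))

  module _ {a : ℕ} (c₂≡ : cs 2 ≡ suc b + a) where

    -- Subtract 1 + b from c₂ = (1 + b)(1 + α). Thus (1 + b)α is integral even where α is a
    -- fraction.
    scaled-α : ℕ→ℚ a ≡ ℕ→ℚ (suc b) *ℚ α
    scaled-α = ∙-cancelˡ (ℕ→ℚ (suc b)) _ _ (begin
      ℕ→ℚ (suc b) +ℚ ℕ→ℚ a                               ≡⟨ ℕ→ℚ-+ (suc b) a ⟨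
      ℕ→ℚ (suc b + a)                                    ≡⟨ cong ℕ→ℚ c₂≡ ⟨
      ℕ→ℚ (cs 2)                                         ≡⟨ c₂-formula ⟩
      ℕ→ℚ (suc b) *ℚ (ℕ→ℚ 1 +ℚ α)                        ≡⟨ ℚ.*-distribˡ-+ (ℕ→ℚ (suc b)) (ℕ→ℚ 1) α ⟩
      ℕ→ℚ (suc b) *ℚ ℕ→ℚ 1 +ℚ ℕ→ℚ (suc b) *ℚ α           ≡⟨ cong (_+ℚ ℕ→ℚ (suc b) *ℚ α) (ℚ.*-identityʳ (ℕ→ℚ (suc b))) ⟩
      ℕ→ℚ (suc b) +ℚ ℕ→ℚ (suc b) *ℚ α                    ∎)
      where open ≡-Reasoning

    -- Multiplying by 1 + b replaces α by `a`; the resulting identity descends from ℚ to ℕ, where 1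
    -- + b is cancelled.
    cs≡intersection : ∀ k → k < 14 → cs (suc k) ≡ intersection b a (suc k)
    cs≡intersection k k<14 = *-cancelˡ-≡ _ _ (suc b) (begin
      suc b * cs (suc k)                       ≡⟨ ℕ→ℚ-injective rational ⟩
      B′ * (suc b + a * B)                     ≡⟨ lemma₁ b a B B′ ⟩
      suc b * B′ + a * (B′ * B)                ≡⟨ cong (λ z → suc b * B′ + a * z) (gauss₂-bracket b k) ⟨
      suc b * B′ + a * (suc b * G)             ≡⟨ lemma₂ b a B′ G ⟩
      suc b * (B′ + a * G)                     ∎)
      where
      open ≡-Reasoning
      B = bracket b k
      B′ = bracket b (suc k)
      G = gauss₂ b (suc k)
      lemma₁ : ∀ b a x y → y * ((1 + b) + a * x) ≡ (1 + b) * y + a * (y * x)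
      lemma₁ = solve-∀
      lemma₂ : ∀ b a x y → (1 + b) * x + a * ((1 + b) * y) ≡ (1 + b) * (x + a * y)
      lemma₂ = solve-∀
      ring : ∀ s y α x → s *ℚ (y *ℚ (ℕ→ℚ 1 +ℚ α *ℚ x)) ≡ y *ℚ (s +ℚ (s *ℚ α) *ℚ x)
      ring = +-*-Solver.solve 4 (λ s y α x →
        s :* (y :* (con (ℕ→ℚ 1) :+ α :* x)) := y :* (s :+ (s :* α) :* x)) refl
        where open +-*-Solver
      rational : ℕ→ℚ (suc b * cs (suc k)) ≡ ℕ→ℚ (B′ * (suc b + a * B))
      rational = begin
        ℕ→ℚ (suc b * cs (suc k))                                         ≡⟨ ℕ→ℚ-* (suc b) (cs (suc k)) ⟩
        ℕ→ℚ (suc b) *ℚ ℕ→ℚ (cs (suc k))                                  ≡⟨ cong (ℕ→ℚ (suc b) *ℚ_) (cs-suc k<14) ⟩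
        ℕ→ℚ (suc b) *ℚ (ℕ→ℚ B′ *ℚ (ℕ→ℚ 1 +ℚ α *ℚ ℕ→ℚ B))                 ≡⟨ ring (ℕ→ℚ (suc b)) (ℕ→ℚ B′) α (ℕ→ℚ B) ⟩
        ℕ→ℚ B′ *ℚ (ℕ→ℚ (suc b) +ℚ (ℕ→ℚ (suc b) *ℚ α) *ℚ ℕ→ℚ B)           ≡⟨ cong (λ z → ℕ→ℚ B′ *ℚ (ℕ→ℚ (suc b) +ℚ z *ℚ ℕ→ℚ B)) scaled-α ⟨
        ℕ→ℚ B′ *ℚ (ℕ→ℚ (suc b) +ℚ ℕ→ℚ a *ℚ ℕ→ℚ B)                        ≡⟨ cong (λ z → ℕ→ℚ B′ *ℚ (ℕ→ℚ (suc b) +ℚ z)) (ℕ→ℚ-* a B) ⟨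
        ℕ→ℚ B′ *ℚ (ℕ→ℚ (suc b) +ℚ ℕ→ℚ (a * B))                           ≡⟨ cong (ℕ→ℚ B′ *ℚ_) (ℕ→ℚ-+ (suc b) (a * B)) ⟨
        ℕ→ℚ B′ *ℚ ℕ→ℚ (suc b + a * B)                                    ≡⟨ ℕ→ℚ-* B′ (suc b + a * B) ⟨
        ℕ→ℚ (B′ * (suc b + a * B))                                       ∎

    α-from-c₂ : ∀ {s} → suc b + a ≡ suc b * (suc b + s) → α ≡ ℕ→ℚ b +ℚ ℕ→ℚ s
    α-from-c₂ {s} eq = trans (ℚ-*-cancelˡ (ℕ→ℚ (suc b)) {{ℕ→ℚ-positive b}} (begin
      ℕ→ℚ (suc b) *ℚ α               ≡⟨ scaled-α ⟨
      ℕ→ℚ a                          ≡⟨ cong ℕ→ℚ (+-cancelˡ-≡ (suc b) _ _ (trans eq (*-suc (suc b) (b + s)))) ⟩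
      ℕ→ℚ (suc b * (b + s))          ≡⟨ ℕ→ℚ-* (suc b) (b + s) ⟩
      ℕ→ℚ (suc b) *ℚ ℕ→ℚ (b + s)     ∎)) (ℕ→ℚ-+ b s)
      where open ≡-Reasoning

-- The bound on α.

α-large : ∀ {n} {Γ : Graph n} {D b α β bs cs} →
  IsDistanceRegular Γ D bs cs → ClassicalParameters D b α β bs cs →
  1 ≤ b → b ≤ 100 → 14 ≤ D → ℕ→ℚ b <ℚ α → ∃[ s ] s * s ≡ b × α ≡ ℕ→ℚ b +ℚ ℕ→ℚ s
α-large {Γ = Γ} {D} {b} {α} {β} {bs} {cs} reg cp 1≤b b≤100 14≤D b<α =
  let s , s²≡b , c₂≡′ = large-c₂ 1≤b b≤100 (subst (suc b * suc b <_) c₂≡ c₂>) divisible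
  in s , s²≡b , α-from-c₂ {D} {b} {α} {β} {bs} {cs} cp 14≤D c₂≡ c₂≡′
  where
  c₂> : suc b * suc b < cs 2
  c₂> = c₂-large {D} {b} {α} {β} {bs} {cs} cp 14≤D b<α
  -- The subtraction is not truncated, because c₂ > (1 + b)² ≥ 1 + b.
  a = cs 2 ∸ suc b
  c₂≡ : cs 2 ≡ suc b + a
  c₂≡ = sym (m+[n∸m]≡n (≤-trans (m≤m*n (suc b) (suc b)) (<⇒≤ c₂>)))
  formula : ∀ m → m ≤ 14 → ∀ k → k < m → cs (suc k) ≡ intersection b a (suc k)
  formula m m≤14 k k<m = cs≡intersection {D} {b} {α} {β} {bs} {cs} cp 14≤D c₂≡ k (≤-trans k<m m≤14)
  divisible : ∀ m → m ≤ 7 → rising (intersection b a) 0 m ∣ rising (intersection b a) m m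
  divisible m m≤7 = subst₂ _∣_
    (rising-cong 0 m (formula m (≤-trans m≤7 (m≤m+n 7 7))))
    (rising-cong m m (formula (m + m) (+-mono-≤ m≤7 m≤7)))
    (rising-divisible Γ {D} {bs} {cs} reg m m (≤-trans (+-mono-≤ m≤7 m≤7) 14≤D))

-- Identifies the root found by the search with the one given in part (ii).
square-injective : ∀ {x y} → x * x ≡ y * y → x ≡ y
square-injective eq = ≤-antisym (≮⇒≥ λ y<x → <⇒≢ (*-mono-< y<x y<x) (sym eq))
                                (≮⇒≥ λ x<y → <⇒≢ (*-mono-< x<y x<y) eq)

theorem1p3 : (n : ℕ) (Γ : Graph n) (D b : ℕ) (α β : ℚ) (bs cs : ℕ → ℕ) →
    IsDistanceRegular Γ D bs cs → ClassicalParameters D b α β bs cs →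
    1 ≤ b → b ≤ 100 → 14 ≤ D →
    (¬ IsPerfectSquare b → α ≤ℚ ℕ→ℚ b)
    × (∀ s → s ℕ.* s ≡ b → (α ≤ℚ ℕ→ℚ b) ⊎ (α ≡ ℕ→ℚ b +ℚ ℕ→ℚ s))
theorem1p3 n Γ D b α β bs cs reg cp 1≤b b≤100 14≤D = conclude (α ℚ.≤? ℕ→ℚ b)
  where
  conclude : Dec (α ≤ℚ ℕ→ℚ b) →
    (¬ IsPerfectSquare b → α ≤ℚ ℕ→ℚ b)
    × (∀ s → s ℕ.* s ≡ b → (α ≤ℚ ℕ→ℚ b) ⊎ (α ≡ ℕ→ℚ b +ℚ ℕ→ℚ s))
  conclude (yes α≤b) = (λ _ → α≤b) , (λ _ _ → inj₁ α≤b)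
  -- When α exceeds `b`, the search yields a square root of `b`, which contradicts the hypothesis of
  -- (i) and gives the second alternative of (ii).
  conclude (no  α≰b) =
    let s , s²≡b , α≡ = α-large {D = D} {b} {α} {β} {bs} {cs} reg cp 1≤b b≤100 14≤D (ℚ.≰⇒> α≰b)
    in (λ ¬square → ⊥-elim (¬square (s , s²≡b))) ,
       (λ s′ s′²≡b → inj₂ (trans α≡ (cong (λ z → ℕ→ℚ b +ℚ ℕ→ℚ z) (square-injective {s} {s′} (trans s²≡b (sym s′²≡b))))))
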